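{- Let $n\ge 2$. Let $E_n(\mathrm{LOP})$ be the set of rankings of the elements of $\Sigma_n$ that are generated by injective objective functions of the Linear Ordering Problem of size $n$. Then $$|E_n(\mathrm{LOP})|\le 2^{n!/2}\left(\frac{n!}{2}\right)!.$$
   Context: $\Sigma_n$ is the symmetric group on $\{1,\dots,n\}$. An objective function of the Linear Ordering Problem (LOP) of size $n$ is a function $f:\Sigma_n\to\mathbb{R}$ of the form $f(\sigma)=\sum_{j=1}^{n-1}\sum_{i=j+1}^{n} a_{\sigma(i)\sigma(j)}$ for some real $n\times n$ matrix $A=[a_{ij}]$. The ranking generated by an injective function $f:\Sigma_n\to\mathbb{R}$ is the total ordering of the $n!$ elements of $\Sigma_n$ obtained by sorting them by increasing value of $f$ (the problem being one of minimization). -}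

module Defs where

open import Data.Nat.Base as ℕ using (ℕ; _⊔_)
import Data.Nat.Properties as ℕₚ
open import Data.Fin.Base using (Fin)
open import Data.Fin.Properties using (_<?_)
open import Data.Fin.Permutation using (Permutation′; _⟨$⟩ʳ_; _≈_)
open import Data.List.Base using (List; map; foldr; filter; allFin)
open import Data.Product.Base using (Σ-syntax; ∃-syntax; _×_; _,_; proj₁)
open import Data.Rational.Base as ℚ using (ℚ; 0ℚ; ½; ∣_∣)
import Data.Rational.Properties as ℚₚ
open import Data.Rational.Solver using (module +-*-Solver)
open import Function.Base using (id; _∘_)
open import Function.Bundles using (_⇔_; mk⇔; Equivalence)
open import Function.Definitions using (Injective)
open import Level using (0ℓ; suc)
open import Relation.Binary.Bundles using (Setoid)
open import Relation.Binary.Core using (Rel)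
open import Relation.Binary.Structures using (IsStrictTotalOrder)
import Relation.Binary.Construct.On as On
open import Relation.Binary.PropositionalEquality

------------------------------------------------------------------------
-- Real numbers: Cauchy sequences of rationals, taken up to _≃_.

record ℝ : Set where
  constructor mkℝ
  field
    seq    : ℕ → ℚ
    cauchy : ∀ ε → 0ℚ ℚ.< ε →
             ∃[ N ] (∀ m n → N ℕ.≤ m → N ℕ.≤ n → ∣ seq m ℚ.- seq n ∣ ℚ.< ε)

open ℝ public

infix 4 _≃_ _<ℝ_

_≃_ : Rel ℝ 0ℓ
x ≃ y = ∀ ε → 0ℚ ℚ.< ε →
        ∃[ N ] (∀ n → N ℕ.≤ n → ∣ seq x n ℚ.- seq y n ∣ ℚ.< ε)

_<ℝ_ : Rel ℝ 0ℓ
x <ℝ y = ∃[ ε ] 0ℚ ℚ.< ε ×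
         (∃[ N ] (∀ n → N ℕ.≤ n → seq x n ℚ.+ ε ℚ.≤ seq y n))

0ℝ : ℝ
0ℝ = mkℝ (λ _ → 0ℚ) λ _ 0<ε → 0 , λ _ _ _ _ → 0<ε

private
  halves : ∀ p → ½ ℚ.* p ℚ.+ ½ ℚ.* p ≡ p
  halves p = trans (sym (ℚₚ.*-distribʳ-+ p ½ ½)) (ℚₚ.*-identityˡ p)

  0<half : ∀ {p} → 0ℚ ℚ.< p → 0ℚ ℚ.< ½ ℚ.* p
  0<half {p} 0<p =
    subst (ℚ._< ½ ℚ.* p) (ℚₚ.*-zeroʳ ½) (ℚₚ.*-monoʳ-<-pos ½ 0<p)

  regroup : ∀ a b c d →
            (a ℚ.+ b) ℚ.- (c ℚ.+ d) ≡ (a ℚ.- c) ℚ.+ (b ℚ.- d)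
  regroup = solve 4 (λ a b c d →
    (a :+ b) :- (c :+ d) := (a :- c) :+ (b :- d)) refl
    where open +-*-Solver

infixl 6 _+ℝ_

_+ℝ_ : ℝ → ℝ → ℝ
seq (x +ℝ y) n = seq x n ℚ.+ seq y n
cauchy (x +ℝ y) ε 0<ε
  with N₁ , p ← cauchy x (½ ℚ.* ε) (0<half 0<ε)
     | N₂ , q ← cauchy y (½ ℚ.* ε) (0<half 0<ε)
  = N₁ ⊔ N₂ , λ m n N≤m N≤n → begin-strict
      ∣ (seq x m ℚ.+ seq y m) ℚ.- (seq x n ℚ.+ seq y n) ∣
        ≡⟨ cong ∣_∣ (regroup (seq x m) (seq y m) (seq x n) (seq y n)) ⟩
      ∣ (seq x m ℚ.- seq x n) ℚ.+ (seq y m ℚ.- seq y n) ∣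
        ≤⟨ ℚₚ.∣p+q∣≤∣p∣+∣q∣ (seq x m ℚ.- seq x n) (seq y m ℚ.- seq y n) ⟩
      ∣ seq x m ℚ.- seq x n ∣ ℚ.+ ∣ seq y m ℚ.- seq y n ∣
        <⟨ ℚₚ.+-mono-<
             (p m n (ℕₚ.m⊔n≤o⇒m≤o N₁ N₂ N≤m) (ℕₚ.m⊔n≤o⇒m≤o N₁ N₂ N≤n))
             (q m n (ℕₚ.m⊔n≤o⇒n≤o N₁ N₂ N≤m) (ℕₚ.m⊔n≤o⇒n≤o N₁ N₂ N≤n)) ⟩
      ½ ℚ.* ε ℚ.+ ½ ℚ.* ε
        ≡⟨ halves ε ⟩
      ε ∎
  where open ℚₚ.≤-Reasoning

sumℝ : List ℝ → ℝ
sumℝ = foldr _+ℝ_ 0ℝ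

------------------------------------------------------------------------
-- The Linear Ordering Problem

Matrix : ℕ → Set
Matrix n = Fin n → Fin n → ℝ

-- Σ_j Σ_{i > j} a_{σ(i)σ(j)}.  The largest index j contributes an empty
-- inner sum, so j may range over all of Fin n.
lop : ∀ {n} → Matrix n → Permutation′ n → ℝ
lop {n} A σ =
  sumℝ (map (λ j →
    sumℝ (map (λ i → A (σ ⟨$⟩ʳ i) (σ ⟨$⟩ʳ j)) (filter (j <?_) (allFin n))))
  (allFin n))

------------------------------------------------------------------------
-- Rankings

record Ranking (n : ℕ) : Set (suc 0ℓ) where
  field
    _≺_                : Rel (Permutation′ n) 0ℓ
    isStrictTotalOrder : IsStrictTotalOrder _≈_ _≺_

rankingSetoid : ℕ → Setoid (suc 0ℓ) 0ℓ
rankingSetoid n = record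
  { Carrier       = Ranking n
  ; _≈_           = λ r s → ∀ σ τ → Ranking._≺_ r σ τ ⇔ Ranking._≺_ s σ τ
  ; isEquivalence = record
    { refl  = λ _ _ → mk⇔ id id
    ; sym   = λ e σ τ → mk⇔ (Equivalence.from (e σ τ)) (Equivalence.to (e σ τ))
    ; trans = λ e f σ τ → mk⇔
        (Equivalence.to (f σ τ) ∘ Equivalence.to (e σ τ))
        (Equivalence.from (e σ τ) ∘ Equivalence.from (f σ τ))
    }
  }

GeneratedBy : ∀ {n} → (Permutation′ n → ℝ) → Ranking n → Set
GeneratedBy f r = ∀ σ τ → (σ ≺ τ) ⇔ (f σ <ℝ f τ)
  where open Ranking r

IsLOPRanking : ∀ {n} → Ranking n → Set
IsLOPRanking {n} r =
  Σ[ A ∈ Matrix n ] Injective _≈_ _≃_ (lop A) × GeneratedBy (lop A) r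

-- E_n(LOP): elements are identified when they are the same ranking,
-- regardless of the matrix witnessing membership.
E-LOP : ℕ → Setoid (suc 0ℓ) 0ℓ
E-LOP n = On.setoid (rankingSetoid n) (proj₁ {B = IsLOPRanking {n}})

{-# OPTIONS --safe #-}

-- Reversing the word of σ turns the sum over pairs i > j into the sum over
-- pairs i < j, so f(σ) + f(reverse σ) does not depend on σ and every LOP ranking
-- satisfies σ ≺ τ ⇒ reverse τ ≺ reverse σ.  In such a ranking the smaller of σ
-- and reverse σ always precedes the larger of τ and reverse τ.  Hence the ranking
-- is determined by which member of each of the n!/2 pairs {σ, reverse σ} is the
-- smaller one (2^(n!/2) choices) and by the order of these smaller members
-- ((n!/2)! choices).
module Submission where

open import Defs
open import Data.Nat.Base using (ℕ; _≤_; _*_; _^_; _/_; _!)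
open import Data.Fin.Base using (Fin)
open import Function.Bundles using (Injection)
open import Relation.Binary.PropositionalEquality using (setoid)

open import Data.Bool.Base using (Bool; true; false; if_then_else_)
import Data.Fin.Base as Fin
import Data.Fin.Permutation as Perm
open import Data.Fin.Permutation using (Permutation; Permutation′; _⟨$⟩ʳ_; _∘ₚ_)
import Data.Fin.Properties as Finₚ
open import Data.Fin.Subset using (Subset; _∈_; ∣_∣)
open import Data.Fin.Subset.Properties using (∣p∣≤n; p⊂q⇒∣p∣<∣q∣)
open import Data.List.Base as List using (filter)
open import Data.Nat.DivMod using (m*n/n≡m)
import Data.Nat.Base as ℕ
import Data.Nat.Properties as ℕₚ
open import Data.Product.Base using (∃-syntax; _×_; _,_; proj₁; proj₂)
open import Data.Rational.Base as ℚ using (ℚ; 0ℚ)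
import Data.Rational.Properties as ℚₚ
open import Data.Rational.Solver using (module +-*-Solver)
open import Data.Sum.Base using (_⊎_; inj₁; inj₂)
import Data.Vec.Base as Vec
open import Data.Vec.Properties using (lookup∘tabulate; tabulate-cong; lookup⇒[]=; []=⇒lookup)
open import Function.Base using (_∘_; _on_; id)
open import Function.Bundles using (_⇔_; mk⇔; module Equivalence; module Inverse)
open import Level using (0ℓ)
open import Relation.Binary.Bundles using (Setoid)
open import Relation.Binary.Core using (Rel)
open import Relation.Binary.Definitions using (Decidable; Tri; tri<; tri≈; tri>)
import Relation.Binary.Construct.On as On
open import Relation.Binary.PropositionalEquality
  using (_≡_; refl; sym; trans; cong; cong₂; subst; module ≡-Reasoning)
open import Relation.Binary.Structures using (IsStrictTotalOrder)
open import Relation.Nullary using (¬_; Dec; does; yes; no)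
open import Relation.Nullary.Decidable using (does-⇔; dec-true; dec-false; decidable-stable)
open import Relation.Nullary.Negation using (contradiction)
open import Relation.Unary using () renaming (Decidable to Decidable₁)

open import Algebra.Properties.CommutativeMonoid.Sum ℚₚ.+-0-commutativeMonoid
  using (sum; sum-cong-≗; ∑-distrib-+; sum-permute)
open Equivalence using (to; from)

private
  variable
    m n : ℕ

-- Lehmer codes of orders on Fin n

subsetOf : {P : Fin n → Set} → Decidable₁ P → Subset n
subsetOf P? = Vec.tabulate (does ∘ P?)

∈-subsetOf : {P : Fin n → Set} (P? : Decidable₁ P) {i : Fin n} → i ∈ subsetOf P? ⇔ P i
∈-subsetOf {P = P} P? {i} = mk⇔
  (λ i∈ → does⇒ (P? i) (trans (sym (lookup∘tabulate _ i)) ([]=⇒lookup i∈)))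
  (λ Pi → lookup⇒[]= i _ (trans (lookup∘tabulate _ i) (dec-true (P? i) Pi)))
  where
  does⇒ : {A : Set} (a? : Dec A) → does a? ≡ true → A
  does⇒ (yes a) _ = a

shift : Rel (Fin (ℕ.suc n)) 0ℓ → Rel (Fin n) 0ℓ
shift R i j = R (Fin.suc i) (Fin.suc j)

belowZero : {R : Rel (Fin (ℕ.suc n)) 0ℓ} → Decidable R → Subset n
belowZero R? = subsetOf λ i → R? (Fin.suc i) Fin.zero

∈-belowZero : {R : Rel (Fin (ℕ.suc n)) 0ℓ} (R? : Decidable R) {i : Fin n} →
              i ∈ belowZero R? ⇔ R (Fin.suc i) Fin.zero
∈-belowZero R? = ∈-subsetOf (λ i → R? (Fin.suc i) Fin.zero)

-- The leading digit counts the elements below `zero`, so it has `suc n` possible values; the other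
-- digits code the order on the successors. In this mixed radix the code fits into `n !`.
lehmer : {R : Rel (Fin n) 0ℓ} → Decidable R → Fin (n !)
lehmer {ℕ.zero}  R? = Fin.zero
lehmer {ℕ.suc n} R? = Fin.combine
  (Fin.fromℕ< (ℕ.s≤s (∣p∣≤n (belowZero R?))))
  (lehmer λ i j → R? (Fin.suc i) (Fin.suc j))

lehmer-cong : {R S : Rel (Fin n) 0ℓ} (R? : Decidable R) (S? : Decidable S) →
              (∀ i j → R i j ⇔ S i j) → lehmer R? ≡ lehmer S?
lehmer-cong {ℕ.zero}  R? S? R⇔S = refl
lehmer-cong {ℕ.suc n} R? S? R⇔S = cong₂ Fin.combine
  (Finₚ.fromℕ<-cong _ _
    (cong ∣_∣ (tabulate-cong λ i → does-⇔ (R⇔S (Fin.suc i) Fin.zero) (R? _ _) (S? _ _))) _ _)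
  (lehmer-cong _ _ λ i j → R⇔S (Fin.suc i) (Fin.suc j))

-- The elements below zero form a down-set, and two down-sets of the same size in
-- a total order coincide.
belowZero-⊆ : {E R S : Rel (Fin (ℕ.suc n)) 0ℓ} (R? : Decidable R) (S? : Decidable S) →
              IsStrictTotalOrder E R → IsStrictTotalOrder E S →
              (∀ i j → shift R i j → shift S i j) →
              ∣ belowZero R? ∣ ≡ ∣ belowZero S? ∣ →
              ∀ i → R (Fin.suc i) Fin.zero → S (Fin.suc i) Fin.zero
belowZero-⊆ {n} {E} {R} {S} R? S? R-sto S-sto R⇒S ∣R∣≡∣S∣ i Ri0 =
  -- Were `suc i` not below `zero` in `S`, the down-set of `S` would be a proper subset of that of
  -- `R`, against their equal sizes.
  decidable-stable (S? _ _) λ ¬Si0 →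
    ℕₚ.<⇒≢ (p⊂q⇒∣p∣<∣q∣ (DS⊆DR ¬Si0 , i , from (∈-belowZero R?) Ri0 , ¬Si0 ∘ to (∈-belowZero S?)))
      (sym ∣R∣≡∣S∣)
  where
  module R = IsStrictTotalOrder R-sto
  module S = IsStrictTotalOrder S-sto
  DS⊆DR : ¬ S (Fin.suc i) Fin.zero → ∀ {j} → j ∈ belowZero S? → j ∈ belowZero R?
  -- If `suc j` is not below `zero` in `R`, then `suc i` precedes it in `R`, hence in `S`, and
  -- through it precedes `zero` in `S`.
  DS⊆DR ¬Si0 {j} j∈ with R.compare (Fin.suc j) Fin.zero
  ... | tri< Rj0 _ _ = from (∈-belowZero R?) Rj0
  ... | tri≈ _ j≈0 _ = contradiction
    (S.trans (R⇒S i j (R.<-respʳ-≈ (R.Eq.sym j≈0) Ri0)) (to (∈-belowZero S?) j∈)) ¬Si0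
  ... | tri> _ _ R0j = contradiction
    (S.trans (R⇒S i j (R.trans Ri0 R0j)) (to (∈-belowZero S?) j∈)) ¬Si0

-- By induction the two orders agree on the successors, and equal counts then put `zero` at the same
-- place. The equality `E` is general because the orders are later pulled back along a map into
-- another type.
lehmer-injective : {E R S : Rel (Fin n) 0ℓ} (R? : Decidable R) (S? : Decidable S) →
                   IsStrictTotalOrder E R → IsStrictTotalOrder E S →
                   lehmer R? ≡ lehmer S? → ∀ i j → R i j → S i j
lehmer-injective {ℕ.suc n} {E} {R} {S} R? S? R-sto S-sto eq = result
  where
  module R = IsStrictTotalOrder R-sto
  module S = IsStrictTotalOrder S-sto
  eqs = Finₚ.combine-injective _ _ _ _ eq
  ∣R∣≡∣S∣ = Finₚ.fromℕ<-injective _ _ _ _ (proj₁ eqs)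

  tail⇒ : ∀ i j → shift R i j → shift S i j
  tail⇒ = lehmer-injective _ _
    (On.isStrictTotalOrder Fin.suc R-sto) (On.isStrictTotalOrder Fin.suc S-sto) (proj₂ eqs)

  tail⇐ : ∀ i j → shift S i j → shift R i j
  tail⇐ = lehmer-injective _ _
    (On.isStrictTotalOrder Fin.suc S-sto) (On.isStrictTotalOrder Fin.suc R-sto) (sym (proj₂ eqs))

  result : ∀ i j → R i j → S i j
  result Fin.zero    Fin.zero    R00 = contradiction R00 (R.irrefl R.Eq.refl)
  result (Fin.suc i) (Fin.suc j) Rij = tail⇒ i j Rij
  result (Fin.suc i) Fin.zero    Ri0 = belowZero-⊆ R? S? R-sto S-sto tail⇒ ∣R∣≡∣S∣ i Ri0
  -- Only elements below `zero` are counted; those above it are reached by trichotomy in `S`.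
  result Fin.zero    (Fin.suc j) R0j with S.compare Fin.zero (Fin.suc j)
  ... | tri< S0j _ _ = S0j
  ... | tri≈ _ 0≈j _ = contradiction R0j (R.irrefl 0≈j)
  ... | tri> _ _ Sj0 = contradiction
    (belowZero-⊆ S? R? S-sto R-sto tail⇐ (sym ∣R∣≡∣S∣) j Sj0) (R.asym R0j)

-- Orders reversed by a fixed-point-free involution

funToFin-cong : {f g : Fin m → Fin n} → (∀ i → f i ≡ g i) → Fin.funToFin f ≡ Fin.funToFin g
funToFin-cong {ℕ.zero}  f≗g = refl
funToFin-cong {ℕ.suc m} f≗g = cong₂ Fin.combine (f≗g Fin.zero) (funToFin-cong (f≗g ∘ Fin.suc))

bitsToFin : (Fin n → Bool) → Fin (2 ^ n)
bitsToFin b = Fin.funToFin (Inverse.from Finₚ.2↔Bool ∘ b)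

bitsToFin-injective : {b c : Fin n → Bool} → bitsToFin b ≡ bitsToFin c → ∀ i → b i ≡ c i
bitsToFin-injective {b = b} {c} eq i = begin
  b i
    ≡⟨ decode b ⟨
  Inverse.to Finₚ.2↔Bool (Fin.finToFun (bitsToFin b) i)
    ≡⟨ cong (λ k → Inverse.to Finₚ.2↔Bool (Fin.finToFun k i)) eq ⟩
  Inverse.to Finₚ.2↔Bool (Fin.finToFun (bitsToFin c) i)
    ≡⟨ decode c ⟩
  c i ∎
  where
  open ≡-Reasoning
  decode : ∀ d → Inverse.to Finₚ.2↔Bool (Fin.finToFun (bitsToFin d) i) ≡ d i
  decode d = trans
    (cong (Inverse.to Finₚ.2↔Bool) (Finₚ.finToFun-funToFin (Inverse.from Finₚ.2↔Bool ∘ d) i))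
    (Inverse.strictlyInverseˡ Finₚ.2↔Bool (d i))

module Involution {A : Set} (_≈_ : Rel A 0ℓ) (ρ : A → A)
                  (ρ-cong : ∀ x y → x ≈ y → ρ x ≈ ρ y)
                  (ρ-involutive : ∀ x → ρ (ρ x) ≈ x)
                  (ρ-free : ∀ x → ¬ x ≈ ρ x) where

  record ReversibleOrder : Set₁ where
    field
      _≺_                : Rel A 0ℓ
      isStrictTotalOrder : IsStrictTotalOrder _≈_ _≺_
      ρ-anti             : ∀ {x y} → x ≺ y → ρ y ≺ ρ x
    open IsStrictTotalOrder isStrictTotalOrder public

    ρ-anti′ : ∀ {x y} → ρ x ≺ ρ y → y ≺ x
    ρ-anti′ = <-respˡ-≈ (ρ-involutive _) ∘ <-respʳ-≈ (ρ-involutive _) ∘ ρ-anti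

    Low : A → Set
    Low x = x ≺ ρ x

    -- If instead `ρ y ≺ x`, reversal gives `ρ x ≺ y`, and `y ≺ ρ y ≺ x ≺ ρ x ≺ y` is a cycle. If
    -- `x ≈ ρ y`, then `Low x` says `ρ y ≺ y`, against `Low y`.
    low≺ρlow : ∀ {x y} → Low x → Low y → x ≺ ρ y
    low≺ρlow {x} {y} x≺ρx y≺ρy with compare x (ρ y)
    ... | tri< x≺ρy _ _ = x≺ρy
    ... | tri≈ _ x≈ρy _ = contradiction
      (<-respˡ-≈ x≈ρy (<-respʳ-≈ (Eq.trans (ρ-cong _ _ x≈ρy) (ρ-involutive y)) x≺ρx))
      (asym y≺ρy)
    ... | tri> _ _ ρy≺x = contradiction
      (trans′ y≺ρy (trans′ ρy≺x (trans′ x≺ρx (<-respʳ-≈ (ρ-involutive y) (ρ-anti ρy≺x)))))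
      (irrefl Eq.refl)
      where trans′ = IsStrictTotalOrder.trans isStrictTotalOrder

  orient : Bool → A → A
  orient b x = if b then x else ρ x

  -- `rep` meets every orbit of `ρ` and is fixed before any order is given, so that the codes of
  -- different orders refer to the same orbits.
  module Encodings {n : ℕ} (rep : Fin n → A)
           (rep-covers : ∀ x → ∃[ k ] (x ≈ rep k ⊎ x ≈ ρ (rep k))) where

    module Encoding (O : ReversibleOrder) where
      open ReversibleOrder O

      isLow : Fin n → Bool
      isLow k = does (rep k <? ρ (rep k))

      low : Fin n → A
      low k = orient (isLow k) (rep k)

      low-isLow : ∀ k → Low (low k)
      -- `_<?_` is computed from `compare`, so this case split also evaluates `isLow k`.
      low-isLow k with compare (rep k) (ρ (rep k))
      ... | tri< x≺ρx _ _ = x≺ρx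
      ... | tri≈ _ x≈ρx _ = contradiction x≈ρx (ρ-free _)
      ... | tri> _ _ ρx≺x = <-respʳ-≈ (Eq.sym (ρ-involutive _)) ρx≺x

      low-covers : ∀ x → ∃[ k ] (x ≈ low k ⊎ x ≈ ρ (low k))
      low-covers x with rep-covers x
      ... | k , x≈ = k , orient-covers (isLow k) x≈
        where
        orient-covers : ∀ b → x ≈ rep k ⊎ x ≈ ρ (rep k) →
                        x ≈ orient b (rep k) ⊎ x ≈ ρ (orient b (rep k))
        orient-covers true  x≈        = x≈
        orient-covers false (inj₁ x≈) = inj₂ (Eq.trans x≈ (Eq.sym (ρ-involutive _)))
        orient-covers false (inj₂ x≈) = inj₁ x≈

      low? : Decidable (_≺_ on low)
      low? i j = low i <? low j

      encode : Fin (2 ^ n * n !)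
      encode = Fin.combine (bitsToFin isLow) (lehmer low?)

    open Encoding using (encode)

    module _ (O O′ : ReversibleOrder) where
      private
        module O  = ReversibleOrder O
        module O′ = ReversibleOrder O′
        module E  = Encoding O
        module E′ = Encoding O′

      encode-cong : (∀ x y → x O.≺ y ⇔ x O′.≺ y) → encode O ≡ encode O′
      encode-cong ≺⇔≺′ = cong₂ Fin.combine
        (funToFin-cong (cong (Inverse.from Finₚ.2↔Bool) ∘ isLow≗))
        (lehmer-cong E.low? E′.low? λ i j →
          subst (λ x → E.low i O.≺ E.low j ⇔ x O′.≺ E′.low j) (low≗ i)
            (subst (λ y → E.low i O.≺ E.low j ⇔ E.low i O′.≺ y) (low≗ j) (≺⇔≺′ _ _)))
        where
        isLow≗ : ∀ k → E.isLow k ≡ E′.isLow k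
        isLow≗ k = does-⇔ (≺⇔≺′ _ _) (rep k O.<? ρ (rep k)) (rep k O′.<? ρ (rep k))
        low≗ : ∀ k → E.low k ≡ E′.low k
        low≗ k = cong (λ b → orient b (rep k)) (isLow≗ k)

      -- Equal bits give both orders the same low members. Two low members are compared by the
      -- Lehmer code, a low one always precedes a high one, and two high ones reduce to low ones by
      -- reversal.
      encode-injective : encode O ≡ encode O′ → ∀ x y → x O.≺ y → x O′.≺ y
      encode-injective eq x y x≺y with E.low-covers x | E.low-covers y
      ... | i , x≈ | j , y≈ = cases x≈ y≈
        where
        eqs = Finₚ.combine-injective _ _ _ _ eq

        low≗ : ∀ k → E.low k ≡ E′.low k
        low≗ k = cong (λ b → orient b (rep k)) (bitsToFin-injective (proj₁ eqs) k)

        -- Pulling `O′` back along `E.low` rather than `E′.low` gives both orders on `Fin n` the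
        -- same underlying equality, as `lehmer-injective` requires.
        low? : Decidable (O′._≺_ on E.low)
        low? i j = E.low i O′.<? E.low j

        low⇒ : ∀ i j → E.low i O.≺ E.low j → E.low i O′.≺ E.low j
        low⇒ = lehmer-injective E.low? low?
          (On.isStrictTotalOrder E.low O.isStrictTotalOrder)
          (On.isStrictTotalOrder E.low O′.isStrictTotalOrder)
          (trans (proj₂ eqs) (lehmer-cong E′.low? low? λ i j →
            mk⇔ (subst id (cong₂ O′._≺_ (sym (low≗ i)) (sym (low≗ j))))
                (subst id (cong₂ O′._≺_ (low≗ i) (low≗ j)))))

        low-isLow′ : ∀ k → O′.Low (E.low k)
        low-isLow′ k = subst O′.Low (sym (low≗ k)) (E′.low-isLow k)

        transport : ∀ {u v} → x ≈ u → y ≈ v → (u O.≺ v → u O′.≺ v) → x O′.≺ y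
        transport x≈u y≈v u≺v⇒ =
          O′.<-respˡ-≈ (O.Eq.sym x≈u) (O′.<-respʳ-≈ (O.Eq.sym y≈v)
            (u≺v⇒ (O.<-respˡ-≈ x≈u (O.<-respʳ-≈ y≈v x≺y))))

        cases : x ≈ E.low i ⊎ x ≈ ρ (E.low i) → y ≈ E.low j ⊎ y ≈ ρ (E.low j) → x O′.≺ y
        cases (inj₁ x≈) (inj₁ y≈) = transport x≈ y≈ (low⇒ i j)
        cases (inj₁ x≈) (inj₂ y≈) = transport x≈ y≈ λ _ →
          O′.low≺ρlow (low-isLow′ i) (low-isLow′ j)
        cases (inj₂ x≈) (inj₁ y≈) = transport x≈ y≈ λ ρu≺v →
          contradiction (O.low≺ρlow (E.low-isLow j) (E.low-isLow i)) (O.asym ρu≺v)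
        cases (inj₂ x≈) (inj₂ y≈) = transport x≈ y≈ λ ρu≺ρv →
          O′.ρ-anti (low⇒ j i (O.ρ-anti′ ρu≺ρv))

-- Permutations up to reversal

-- `∘ₚ` applies its left factor first, so positions are reversed and not values: the word of `σ` is
-- read backwards.
reversed : Permutation′ n → Permutation′ n
reversed σ = Perm.reverse ∘ₚ σ

reversed-cong : (σ τ : Permutation′ n) → σ Perm.≈ τ → reversed σ Perm.≈ reversed τ
reversed-cong _ _ σ≈τ = σ≈τ ∘ Fin.opposite

reversed-involutive : (σ : Permutation′ n) → reversed (reversed σ) Perm.≈ σ
reversed-involutive σ i = cong (σ ⟨$⟩ʳ_) (Finₚ.opposite-involutive i)

⟨$⟩ʳ-injective : (σ : Permutation′ n) {i j : Fin n} → σ ⟨$⟩ʳ i ≡ σ ⟨$⟩ʳ j → i ≡ j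
⟨$⟩ʳ-injective σ eq =
  trans (sym (Perm.inverseˡ σ)) (trans (cong (σ Perm.⟨$⟩ˡ_) eq) (Perm.inverseˡ σ))

-- With at least two positions the first and the last differ, and `σ` cannot put the same letter on
-- both.
reversed-free : (σ : Permutation′ (2 ℕ.+ m)) → ¬ σ Perm.≈ reversed σ
reversed-free σ σ≈ with () ← ⟨$⟩ʳ-injective σ (σ≈ Fin.zero)

punchIn-fromℕ : (k : Fin n) → Fin.punchIn (Fin.fromℕ n) k ≡ Fin.inject₁ k
punchIn-fromℕ Fin.zero    = refl
punchIn-fromℕ (Fin.suc k) = cong Fin.suc (punchIn-fromℕ k)

punchIn-inject₁-fromℕ : (i : Fin (ℕ.suc n)) →
  Fin.punchIn (Fin.inject₁ i) (Fin.fromℕ n) ≡ Fin.fromℕ (ℕ.suc n)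
punchIn-inject₁-fromℕ {n}       Fin.zero    = refl
punchIn-inject₁-fromℕ {ℕ.suc n} (Fin.suc i) = cong Fin.suc (punchIn-inject₁-fromℕ i)

punchIn-inject₁ : (i : Fin (ℕ.suc n)) (k : Fin n) →
  Fin.punchIn (Fin.inject₁ i) (Fin.inject₁ k) ≡ Fin.inject₁ (Fin.punchIn i k)
punchIn-inject₁ Fin.zero    k           = refl
punchIn-inject₁ (Fin.suc i) Fin.zero    = refl
punchIn-inject₁ (Fin.suc i) (Fin.suc k) = cong Fin.suc (punchIn-inject₁ i k)

-- This moves the insertion place to its mirror image when a word is reversed. As `opposite` yields
-- `fromℕ` at `zero` and `inject₁` at `suc`, the induction rests on `punchIn` at these two.
opposite-punchIn : (i : Fin (ℕ.suc n)) (k : Fin n) →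
  Fin.opposite (Fin.punchIn i k) ≡ Fin.punchIn (Fin.opposite i) (Fin.opposite k)
opposite-punchIn Fin.zero    k           = sym (punchIn-fromℕ _)
opposite-punchIn (Fin.suc i) Fin.zero    = sym (punchIn-inject₁-fromℕ _)
opposite-punchIn (Fin.suc i) (Fin.suc k) =
  trans (cong Fin.inject₁ (opposite-punchIn i k)) (sym (punchIn-inject₁ _ _))

insert-unique : ∀ i j (π : Permutation m n) (σ : Permutation (ℕ.suc m) (ℕ.suc n)) →
  σ ⟨$⟩ʳ i ≡ j → (∀ k → σ ⟨$⟩ʳ Fin.punchIn i k ≡ Fin.punchIn j (π ⟨$⟩ʳ k)) →
  σ Perm.≈ Perm.insert i j π
-- `Perm.insert` makes the same test, so each branch evaluates the right-hand side.
insert-unique i j π σ σi≡j σ-punchIn x with i Finₚ.≟ x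
... | yes refl = σi≡j
... | no  i≢x  =
  trans (cong (σ ⟨$⟩ʳ_) (sym (Finₚ.punchIn-punchOut i≢x))) (σ-punchIn (Fin.punchOut i≢x))

-- This is (2 + m)!/2, written as a product so that an index splits into an insertion place and the
-- index of a shorter word.
#reps : ℕ → ℕ
#reps ℕ.zero    = 1
#reps (ℕ.suc m) = (3 ℕ.+ m) * #reps m

-- Every word on 3 + m letters arises by inserting the letter 0 somewhere in a word
-- on 2 + m letters, and reversal only moves the place of insertion.
reps : ∀ m → Fin (#reps m) → Permutation′ (2 ℕ.+ m)
reps ℕ.zero    _ = Perm.id
reps (ℕ.suc m) k = Perm.insert (proj₁ il) Fin.zero (reps m (proj₂ il))
  where
  il : Fin (3 ℕ.+ m) × Fin (#reps m)
  il = Fin.remQuot (#reps m) k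

reps-combine : ∀ i l → reps (ℕ.suc m) (Fin.combine i l) ≡ Perm.insert i Fin.zero (reps m l)
reps-combine {m} i l =
  cong (λ il → Perm.insert (proj₁ il) Fin.zero (reps m (proj₂ il))) (Finₚ.remQuot-combine i l)

-- Induction on `m`: deleting the letter `zero` from `σ` leaves a shorter word that is a
-- representative or the reversal of one, and `zero` is then put back.
reps-cover : ∀ m (σ : Permutation′ (2 ℕ.+ m)) →
             ∃[ k ] (σ Perm.≈ reps m k ⊎ σ Perm.≈ reversed (reps m k))
reps-cover ℕ.zero σ
  with σ ⟨$⟩ʳ Fin.zero in eq₀ | σ ⟨$⟩ʳ Fin.suc Fin.zero in eq₁
... | Fin.zero | Fin.zero
      with () ← ⟨$⟩ʳ-injective σ (trans eq₀ (sym eq₁))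
... | Fin.suc Fin.zero | Fin.suc Fin.zero
      with () ← ⟨$⟩ʳ-injective σ (trans eq₀ (sym eq₁))
-- The two words on two letters are reversals of each other, so the identity represents both.
... | Fin.zero | Fin.suc Fin.zero =
      Fin.zero , inj₁ λ { Fin.zero → eq₀ ; (Fin.suc Fin.zero) → eq₁ }
... | Fin.suc Fin.zero | Fin.zero =
      Fin.zero , inj₂ λ { Fin.zero → eq₀ ; (Fin.suc Fin.zero) → eq₁ }
reps-cover (ℕ.suc m) σ = extend (reps-cover m (Perm.remove i σ))
  where
  i : Fin (3 ℕ.+ m)
  i = σ Perm.⟨$⟩ˡ Fin.zero

  σ-punchIn : ∀ k → σ ⟨$⟩ʳ Fin.punchIn i k ≡ Fin.suc (Perm.remove i σ ⟨$⟩ʳ k)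
  σ-punchIn = Perm.punchIn-permute′ σ Fin.zero

  extend : ∃[ l ] (Perm.remove i σ Perm.≈ reps m l ⊎ Perm.remove i σ Perm.≈ reversed (reps m l)) →
           ∃[ k ] (σ Perm.≈ reps (ℕ.suc m) k ⊎ σ Perm.≈ reversed (reps (ℕ.suc m) k))
  extend (l , inj₁ w≈) = Fin.combine i l , inj₁
    (subst (σ Perm.≈_) (sym (reps-combine i l))
      (insert-unique i Fin.zero (reps m l) σ (Perm.inverseʳ σ)
        λ k → trans (σ-punchIn k) (cong Fin.suc (w≈ k))))
  -- Here it is `reversed σ` that arises from the representative `reps m l`, and in it `zero` stands
  -- at the mirrored position `Fin.opposite i`.
  extend (l , inj₂ w≈) = Fin.combine (Fin.opposite i) l , inj₂ λ x → begin
    σ ⟨$⟩ʳ x                                  ≡⟨ cong (σ ⟨$⟩ʳ_) (Finₚ.opposite-involutive x) ⟨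
    reversed σ ⟨$⟩ʳ Fin.opposite x
      ≡⟨ insert-unique (Fin.opposite i) Fin.zero (reps m l) (reversed σ)
           (trans (cong (σ ⟨$⟩ʳ_) (Finₚ.opposite-involutive i)) (Perm.inverseʳ σ))
           reversed-punchIn (Fin.opposite x) ⟩
    Perm.insert (Fin.opposite i) Fin.zero (reps m l) ⟨$⟩ʳ Fin.opposite x
      ≡⟨ cong (_⟨$⟩ʳ Fin.opposite x) (reps-combine (Fin.opposite i) l) ⟨
    reversed (reps (ℕ.suc m) (Fin.combine (Fin.opposite i) l)) ⟨$⟩ʳ x ∎
    where
    open ≡-Reasoning
    reversed-punchIn : ∀ k → reversed σ ⟨$⟩ʳ Fin.punchIn (Fin.opposite i) k ≡
                             Fin.suc (reps m l ⟨$⟩ʳ k)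
    reversed-punchIn k = begin
      σ ⟨$⟩ʳ Fin.opposite (Fin.punchIn (Fin.opposite i) k)
        ≡⟨ cong (σ ⟨$⟩ʳ_) (opposite-punchIn (Fin.opposite i) k) ⟩
      σ ⟨$⟩ʳ Fin.punchIn (Fin.opposite (Fin.opposite i)) (Fin.opposite k)
        ≡⟨ cong (λ j → σ ⟨$⟩ʳ Fin.punchIn j (Fin.opposite k)) (Finₚ.opposite-involutive i) ⟩
      σ ⟨$⟩ʳ Fin.punchIn i (Fin.opposite k)
        ≡⟨ σ-punchIn (Fin.opposite k) ⟩
      Fin.suc (Perm.remove i σ ⟨$⟩ʳ Fin.opposite k)
        ≡⟨ cong Fin.suc (w≈ (Fin.opposite k)) ⟩
      Fin.suc (reps m l ⟨$⟩ʳ Fin.opposite (Fin.opposite k))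
        ≡⟨ cong (λ j → Fin.suc (reps m l ⟨$⟩ʳ j)) (Finₚ.opposite-involutive k) ⟩
      Fin.suc (reps m l ⟨$⟩ʳ k) ∎

#reps*2 : ∀ m → #reps m * 2 ≡ (2 ℕ.+ m) !
#reps*2 ℕ.zero    = refl
#reps*2 (ℕ.suc m) = trans (ℕₚ.*-assoc (3 ℕ.+ m) (#reps m) 2) (cong ((3 ℕ.+ m) *_) (#reps*2 m))

#reps≡ : ∀ m → #reps m ≡ (2 ℕ.+ m) ! / 2
#reps≡ m = trans (sym (m*n/n≡m (#reps m) 2)) (cong (_/ 2) (#reps*2 m))

-- The objective function and reversal

when : {P : Set} → Dec P → ℚ → ℚ
when P? x = if does P? then x else 0ℚ

module _ (N : ℕ) where

  -- Addition of reals is termwise, so the `N`-th terms are sums of rationals, in which filtered-out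
  -- indices become zeros. The map `f` is general because the induction on `tabulate` shifts it.
  seq-sumℝ : {P : Fin n → Set} (P? : Decidable₁ P) (g : Fin n → ℝ) (f : Fin m → Fin n) →
             seq (sumℝ (List.map g (filter P? (List.tabulate f)))) N ≡
             sum (λ i → when (P? (f i)) (seq (g (f i)) N))
  seq-sumℝ {m = ℕ.zero}  P? g f = refl
  seq-sumℝ {m = ℕ.suc m} P? g f with does (P? (f Fin.zero))
  ... | true  = cong (seq (g (f Fin.zero)) N ℚ.+_) (seq-sumℝ P? g (f ∘ Fin.suc))
  ... | false = trans (seq-sumℝ P? g (f ∘ Fin.suc)) (sym (ℚₚ.+-identityˡ _))

  seq-sumℝ-all : (g : Fin n → ℝ) (f : Fin m → Fin n) →
                 seq (sumℝ (List.map g (List.tabulate f))) N ≡ sum (λ i → seq (g (f i)) N)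
  seq-sumℝ-all {m = ℕ.zero}  g f = refl
  seq-sumℝ-all {m = ℕ.suc m} g f =
    cong (seq (g (f Fin.zero)) N ℚ.+_) (seq-sumℝ-all g (f ∘ Fin.suc))

∑∑ : (Fin n → Fin n → ℚ) → ℚ
∑∑ b = sum λ j → sum λ i → b i j

∑∑-cong : {b c : Fin n → Fin n → ℚ} → (∀ i j → b i j ≡ c i j) → ∑∑ b ≡ ∑∑ c
∑∑-cong b≗c = sum-cong-≗ λ j → sum-cong-≗ λ i → b≗c i j

∑∑-permute : (b : Fin n → Fin n → ℚ) (π : Permutation′ n) →
             ∑∑ b ≡ ∑∑ (λ i j → b (π ⟨$⟩ʳ i) (π ⟨$⟩ʳ j))
∑∑-permute b π = trans
  (sum-permute (λ j → sum λ i → b i j) π)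
  (sum-cong-≗ λ j → sum-permute (λ i → b i (π ⟨$⟩ʳ j)) π)

∑∑-+ : (b c : Fin n → Fin n → ℚ) → ∑∑ b ℚ.+ ∑∑ c ≡ ∑∑ (λ i j → b i j ℚ.+ c i j)
∑∑-+ b c = sym (trans
  (sum-cong-≗ λ j → ∑-distrib-+ (λ i → b i j) (λ i → c i j))
  (∑-distrib-+ (λ j → sum λ i → b i j) (λ j → sum λ i → c i j)))

opposite-anti-< : {i j : Fin n} → i Fin.< j → Fin.opposite j Fin.< Fin.opposite i
opposite-anti-< {n} {i} {j} i<j
  rewrite Finₚ.opposite-prop i | Finₚ.opposite-prop j =
  ℕₚ.∸-monoʳ-< (ℕ.s≤s i<j) (Finₚ.toℕ<n j)

opposite-<⇔ : (i j : Fin n) → Fin.opposite j Fin.< Fin.opposite i ⇔ i Fin.< j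
opposite-<⇔ i j = mk⇔
  (λ j′<i′ → subst id (cong₂ Fin._<_ (Finₚ.opposite-involutive i) (Finₚ.opposite-involutive j))
    (opposite-anti-< j′<i′))
  opposite-anti-<

offDiagonal : (Fin n → Fin n → ℚ) → Fin n → Fin n → ℚ
offDiagonal b i j = if does (i Finₚ.≟ j) then 0ℚ else b i j

-- Joins the two triangles of a matrix: an entry off the diagonal lies in exactly one of them, a
-- diagonal entry in neither.
when-tri : {P E Q : Set} → Tri P E Q → (P? : Dec P) (E? : Dec E) (Q? : Dec Q) (x : ℚ) →
           when Q? x ℚ.+ when P? x ≡ (if does E? then 0ℚ else x)
when-tri (tri< p ¬e ¬q) P? E? Q? x
  rewrite dec-true P? p | dec-false E? ¬e | dec-false Q? ¬q = ℚₚ.+-identityˡ x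
when-tri (tri≈ ¬p e ¬q) P? E? Q? x
  rewrite dec-false P? ¬p | dec-true E? e | dec-false Q? ¬q = refl
when-tri (tri> ¬p ¬e q) P? E? Q? x
  rewrite dec-false P? ¬p | dec-false E? ¬e | dec-true Q? q = ℚₚ.+-identityʳ x

module _ (A : Matrix n) (N : ℕ) where

  entry : Fin n → Fin n → ℚ
  entry i j = seq (A i j) N

  seq-lop : (σ : Permutation′ n) →
    seq (lop A σ) N ≡ ∑∑ λ i j → when (j Finₚ.<? i) (entry (σ ⟨$⟩ʳ i) (σ ⟨$⟩ʳ j))
  seq-lop σ = trans
    (seq-sumℝ-all N {n} {n} _ id)
    (sum-cong-≗ λ j → seq-sumℝ N (j Finₚ.<?_) (λ i → A (σ ⟨$⟩ʳ i) (σ ⟨$⟩ʳ j)) id)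

  -- Reindexing both sums by `opposite` undoes the reversal inside the entries and flips the
  -- condition on the indices.
  seq-lop-reversed : (σ : Permutation′ n) →
    seq (lop A (reversed σ)) N ≡ ∑∑ λ i j → when (i Finₚ.<? j) (entry (σ ⟨$⟩ʳ i) (σ ⟨$⟩ʳ j))
  seq-lop-reversed σ = begin
    seq (lop A (reversed σ)) N
      ≡⟨ seq-lop (reversed σ) ⟩
    ∑∑ (λ i j → when (j Finₚ.<? i) (b (Fin.opposite i) (Fin.opposite j)))
      ≡⟨ ∑∑-cong (λ i j → cong (if_then b (Fin.opposite i) (Fin.opposite j) else 0ℚ)
           (does-⇔ (opposite-<⇔ j i) (Fin.opposite i Finₚ.<? Fin.opposite j) (j Finₚ.<? i))) ⟨
    ∑∑ (λ i j → when (Fin.opposite i Finₚ.<? Fin.opposite j) (b (Fin.opposite i) (Fin.opposite j)))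
      ≡⟨ ∑∑-permute (λ i j → when (i Finₚ.<? j) (b i j)) Perm.reverse ⟨
    ∑∑ (λ i j → when (i Finₚ.<? j) (b i j)) ∎
    where
    open ≡-Reasoning
    b : Fin n → Fin n → ℚ
    b i j = entry (σ ⟨$⟩ʳ i) (σ ⟨$⟩ʳ j)

  -- The two triangles together contain every off-diagonal entry once. Being injective, `σ`
  -- preserves the diagonal and its complement, so reindexing by `σ` removes it from the sum.
  lop+lop-reversed : (σ : Permutation′ n) →
    seq (lop A σ) N ℚ.+ seq (lop A (reversed σ)) N ≡ ∑∑ (offDiagonal entry)
  lop+lop-reversed σ = begin
    seq (lop A σ) N ℚ.+ seq (lop A (reversed σ)) N
      ≡⟨ cong₂ ℚ._+_ (seq-lop σ) (seq-lop-reversed σ) ⟩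
    ∑∑ (λ i j → when (j Finₚ.<? i) (b i j)) ℚ.+ ∑∑ (λ i j → when (i Finₚ.<? j) (b i j))
      ≡⟨ ∑∑-+ (λ i j → when (j Finₚ.<? i) (b i j)) (λ i j → when (i Finₚ.<? j) (b i j)) ⟩
    ∑∑ (λ i j → when (j Finₚ.<? i) (b i j) ℚ.+ when (i Finₚ.<? j) (b i j))
      ≡⟨ ∑∑-cong (λ i j → when-tri (Finₚ.<-cmp i j) (i Finₚ.<? j) (i Finₚ.≟ j) (j Finₚ.<? i) (b i j)) ⟩
    ∑∑ (offDiagonal b)
      ≡⟨ ∑∑-cong (λ i j → cong (if_then 0ℚ else b i j)
           (does-⇔ (mk⇔ (cong (σ ⟨$⟩ʳ_)) (⟨$⟩ʳ-injective σ))
             (i Finₚ.≟ j) ((σ ⟨$⟩ʳ i) Finₚ.≟ (σ ⟨$⟩ʳ j)))) ⟩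
    ∑∑ (λ i j → offDiagonal entry (σ ⟨$⟩ʳ i) (σ ⟨$⟩ʳ j))
      ≡⟨ ∑∑-permute (offDiagonal entry) σ ⟨
    ∑∑ (offDiagonal entry) ∎
    where
    open ≡-Reasoning
    b : Fin n → Fin n → ℚ
    b i j = entry (σ ⟨$⟩ʳ i) (σ ⟨$⟩ʳ j)

-- Add `q′ - p` to both sides of the assumed inequality and use that both sums equal `c`.
+-exchange-≤ : ∀ {p p′ q q′ c} ε → p ℚ.+ p′ ≡ c → q ℚ.+ q′ ≡ c →
               p ℚ.+ ε ℚ.≤ q → q′ ℚ.+ ε ℚ.≤ p′
+-exchange-≤ {p} {p′} {q} {q′} {c} ε p+p′≡c q+q′≡c p+ε≤q = begin
  q′ ℚ.+ ε                              ≡⟨ solve 3 (λ p q′ ε → q′ :+ ε := (p :+ ε) :+ (q′ :- p)) refl p q′ ε ⟩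
  (p ℚ.+ ε) ℚ.+ (q′ ℚ.- p)              ≤⟨ ℚₚ.+-monoˡ-≤ (q′ ℚ.- p) p+ε≤q ⟩
  q ℚ.+ (q′ ℚ.- p)                      ≡⟨ solve 3 (λ p q q′ → q :+ (q′ :- p) := (q :+ q′) :- p) refl p q q′ ⟩
  (q ℚ.+ q′) ℚ.- p                      ≡⟨ cong (ℚ._- p) (trans q+q′≡c (sym p+p′≡c)) ⟩
  (p ℚ.+ p′) ℚ.- p                      ≡⟨ solve 2 (λ p p′ → (p :+ p′) :- p := p′) refl p p′ ⟩
  p′                                    ∎
  where
  open ℚₚ.≤-Reasoning
  open +-*-Solver

-- The constant-sum identity is exact at every index `k`, so the gap `ε` and the threshold `N` carry
-- over unchanged.
lop-reversed-anti : (A : Matrix n) (σ τ : Permutation′ n) →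
                    lop A σ <ℝ lop A τ → lop A (reversed τ) <ℝ lop A (reversed σ)
lop-reversed-anti A σ τ (ε , 0<ε , N , σ<τ) = ε , 0<ε , N , λ k N≤k →
  +-exchange-≤ {p = seq (lop A σ) k} {q = seq (lop A τ) k} ε (lop+lop-reversed A k σ) (lop+lop-reversed A k τ) (σ<τ k N≤k)

-- The bound on the number of LOP rankings

mainTheorem3 : (n : ℕ) → 2 ≤ n →
    Injection (E-LOP n) (setoid (Fin (2 ^ (n ! / 2) * (n ! / 2) !)))
mainTheorem3 (ℕ.suc (ℕ.suc m)) (ℕ.s≤s (ℕ.s≤s _)) =
  -- The codes are built with `#reps m` representatives; only the size of the target is rewritten to
  -- the quotient by 2.
  subst (λ h → Injection (E-LOP (2 ℕ.+ m)) (setoid (Fin (2 ^ h * h !)))) (#reps≡ m) record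
    { to        = encode ∘ order
    ; cong      = λ {r} {s} → encode-cong (order r) (order s)
    ; injective = λ {r} {s} eq σ τ → mk⇔
        (encode-injective (order r) (order s) eq σ τ)
        (encode-injective (order s) (order r) (sym eq) σ τ)
    }
  where
  open Involution {Permutation′ (2 ℕ.+ m)} Perm._≈_ reversed
    reversed-cong reversed-involutive reversed-free
  open Encodings (reps m) (reps-cover m)
  open Encoding using (encode)

  order : Setoid.Carrier (E-LOP (2 ℕ.+ m)) → ReversibleOrder
  order (r , A , _ , generated) = record
    { _≺_                = Ranking._≺_ r
    ; isStrictTotalOrder = Ranking.isStrictTotalOrder r
    ; ρ-anti             = λ {σ} {τ} →
        -- The ranking is translated into values of the objective function, reversed there, and
        -- translated back.
        from (generated _ _) ∘ lop-reversed-anti A σ τ ∘ to (generated σ τ)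
    }
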